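{- Let $X$ be a finite group with $|X|=n$ and let $S\subseteq X$ be a generating set with $|S|=d$ and $S^{ -1}=S$. Let $G$ be the Cayley graph $(X,S)$, and suppose $G$ is not bipartite. Assume $\beta(G)<\tfrac{1}{16d}$. Then $$h(G)\leq \frac{100\,\beta(G)}{1-16d\,\beta(G)}.$$
   Context: The Cayley graph $(X,S)$ has vertex set $X$ and edges $g\sim gs$ for all $g\in X$, $s\in S$; it is $d$-regular. For $A,B\subseteq X$, $e(A,B)$ is the number of ordered pairs $(a,b)\in A\times B$ with $a\sim b$. For $A\subseteq X$, $\partial(A)$ is the set of edges with exactly one endpoint in $A$. The edge Cheeger constant is $h(G)=\min\{|\partial(A)|/(d|A|) : A\subseteq X,\ 0<|A|\le n/2\}$. For disjoint $L,R\subseteq X$ with $L\cup R\ne\emptyset$, $b(L,R)=\dfrac{e(L,L)+e(R,R)+|\partial(L\cup R)|}{d\,|L\cup R|}$, and the bipartiteness constant is $\beta(G)=\min_{L,R}b(L,R)$ over all such pairs. -}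

module Defs where

open import Algebra.Bundles using (Group)
import Algebra.Properties.Group as GroupProperties
open import Data.Fin.Base as Fin using (Fin)
import Data.Fin.Properties as Fin
open import Data.Fin.Subset
open import Data.Fin.Subset.Properties using (_∈?_; x∈p⇒∣p-x∣<∣p∣)
open import Data.Integer.Base using (+_)
open import Data.List.Base using (List; length; filter; cartesianProduct; allFin)
open import Data.Nat.Base as ℕ using (ℕ; NonZero; >-nonZero)
import Data.Nat.Properties as ℕ
open import Data.Product.Base using (Σ; ∃; _×_; _,_)
open import Data.Rational.Base as ℚ using (ℚ; _/_; 1ℚ)
import Data.Rational.Properties as ℚ
import Data.Rational.Unnormalised.Base as ℚᵘ
import Data.Rational.Unnormalised.Properties as ℚᵘ
open import Data.Sum.Base using (_⊎_)
open import Function.Bundles using (Inverse; _⇔_; module Equivalence)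
open import Level using (_⊔_)
open import Relation.Binary.PropositionalEquality
  using (_≡_; refl; sym; trans; cong; subst; setoid)
import Relation.Binary.Reasoning.Setoid as ≈-Reasoning
open import Relation.Nullary.Decidable.Core using (Dec; ¬?; _×-dec_; _⊎-dec_)
open import Relation.Nullary.Negation.Core using (¬_; contradiction)

private
  variable
    n : ℕ

IsMinimum : {I : Set} → (I → ℚ) → ℚ → Set
IsMinimum f m = (∃ λ i → f i ≡ m) × (∀ i → m ℚ.≤ f i)

------------------------------------------------------------------------
-- Finite undirected graphs on Fin n, without multiple edges, loops allowed

record Graph (n : ℕ) : Set₁ where
  field
    Adj      : Fin n → Fin n → Set
    adj?     : ∀ x y → Dec (Adj x y)
    adj-sym  : ∀ {x y} → Adj x y → Adj y x

module _ (G : Graph n) where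
  open Graph G

  Bipartite : Set
  Bipartite = ∃ λ (L : Subset n) → ∀ {x y} → Adj x y →
                (x ∈ L × y ∉ L) ⊎ (x ∉ L × y ∈ L)

  pairs : List (Fin n × Fin n)
  pairs = cartesianProduct (allFin n) (allFin n)

  e : Subset n → Subset n → ℕ
  e A B = length (filter
    (λ (a , b) → (a ∈? A) ×-dec (b ∈? B) ×-dec adj? a b) pairs)

  -- The edge {x , y} is represented by the ordered pair with x ≤ y.
  edges : List (Fin n × Fin n)
  edges = filter (λ (x , y) → (x Fin.≤? y) ×-dec adj? x y) pairs

  ∂ : Subset n → List (Fin n × Fin n)
  ∂ A = filter (λ (x , y) → ((x ∈? A) ×-dec ¬? (y ∈? A)) ⊎-dec
                            (¬? (x ∈? A) ×-dec (y ∈? A))) edges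

  -- In the remaining definitions d stands for the degree of G.

  expansion : (d : ℕ) .{{_ : NonZero d}} (A : Subset n) → 0 ℕ.< ∣ A ∣ → ℚ
  expansion d A 0<∣A∣ = + length (∂ A) / (d ℕ.* ∣ A ∣)
    where instance
      ∣A∣≢0  = >-nonZero 0<∣A∣
      d∣A∣≢0 = ℕ.m*n≢0 d ∣ A ∣

  -- When n ≤ 1 the minimum is over the empty family, and no h qualifies.
  IsEdgeCheegerConstant : (d : ℕ) .{{_ : NonZero d}} → ℚ → Set
  IsEdgeCheegerConstant d = IsMinimum
    {I = Σ (Subset n) λ A → 0 ℕ.< ∣ A ∣ × 2 ℕ.* ∣ A ∣ ℕ.≤ n}
    (λ (A , 0<∣A∣ , _) → expansion d A 0<∣A∣)

  private
    nonempty⇒0<∣_∣ : (p : Subset n) → Nonempty p → 0 ℕ.< ∣ p ∣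
    nonempty⇒0<∣ p ∣ (_ , x∈p) = ℕ.≤-<-trans ℕ.z≤n (x∈p⇒∣p-x∣<∣p∣ x∈p)

  b : (d : ℕ) .{{_ : NonZero d}} (L R : Subset n) → Nonempty (L ∪ R) → ℚ
  b d L R L∪R≢∅ =
    + (e L L ℕ.+ e R R ℕ.+ length (∂ (L ∪ R))) / (d ℕ.* ∣ L ∪ R ∣)
    where instance
      ∣L∪R∣≢0  = >-nonZero (nonempty⇒0<∣ L ∪ R ∣ L∪R≢∅)
      d∣L∪R∣≢0 = ℕ.m*n≢0 d ∣ L ∪ R ∣

  IsBipartitenessConstant : (d : ℕ) .{{_ : NonZero d}} → ℚ → Set
  IsBipartitenessConstant d = IsMinimum
    {I = Σ (Subset n × Subset n) λ (L , R) → Empty (L ∩ R) × Nonempty (L ∪ R)}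
    (λ ((L , R) , _ , L∪R≢∅) → b d L R L∪R≢∅)

------------------------------------------------------------------------
-- Cayley graphs of finite groups.  The group is arbitrary; a bijection
-- with Fin n expresses that it has n elements, and subsets and vertices
-- are transported along it.

_HasOrder_ : ∀ {c ℓ} → Group c ℓ → ℕ → Set (c ⊔ ℓ)
X HasOrder n = Inverse (Group.setoid X) (setoid (Fin n))

module _ {c ℓ} (X : Group c ℓ) (enum : X HasOrder n) (S : Subset n) where
  open Group X using (Carrier; _≈_; _∙_; ε; _⁻¹)
  open Inverse enum using (to; from; inverseˡ; strictlyInverseʳ)

  private
    _∈ₛ : Carrier → Set
    x ∈ₛ = to x ∈ S

  data Generated : Carrier → Set (c ⊔ ℓ) where
    gen  : ∀ {x} → x ∈ₛ → Generated x
    unit : Generated ε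
    mul  : ∀ {x y} → Generated x → Generated y → Generated (x ∙ y)
    inv  : ∀ {x} → Generated x → Generated (x ⁻¹)
    resp : ∀ {x y} → x ≈ y → Generated x → Generated y

  IsGenerating : Set (c ⊔ ℓ)
  IsGenerating = ∀ x → Generated x

  -- S⁻¹ = S, where S⁻¹ = { s⁻¹ : s ∈ S }
  IsInverseClosed : Set (c ⊔ ℓ)
  IsInverseClosed = ∀ x → (∃ λ s → s ∈ₛ × x ≈ s ⁻¹) ⇔ x ∈ₛ

  cayleyGraph : IsInverseClosed → Graph n
  cayleyGraph S⁻¹=S = record
    { Adj     = Adj
    ; adj?    = λ g h → Fin.any? λ s → (s ∈? S) ×-dec (to (from g ∙ from s) Fin.≟ h)
    ; adj-sym = adj-sym
    }
    where
    open Group X using (∙-cong; ∙-congˡ; assoc; identityʳ; inverseʳ) renaming (refl to ≈-refl)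
    open ≈-Reasoning (Group.setoid X)

    Adj : Fin n → Fin n → Set
    Adj g h = ∃ λ s → s ∈ S × to (from g ∙ from s) ≡ h

    adj-sym : ∀ {g h} → Adj g h → Adj h g
    adj-sym {g} (s , s∈S , refl) =
      to (from s ⁻¹) ,
      Equivalence.to (S⁻¹=S (from s ⁻¹))
        (from s , subst (_∈ S) (sym (inverseˡ ≈-refl)) s∈S , ≈-refl) ,
      inverseˡ (begin
        from (to (from g ∙ from s)) ∙ from (to (from s ⁻¹))
          ≈⟨ ∙-cong (strictlyInverseʳ _) (strictlyInverseʳ _) ⟩
        (from g ∙ from s) ∙ from s ⁻¹  ≈⟨ assoc _ _ _ ⟩
        from g ∙ (from s ∙ from s ⁻¹)  ≈⟨ ∙-congˡ (inverseʳ (from s)) ⟩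
        from g ∙ ε                     ≈⟨ identityʳ (from g) ⟩
        from g                         ∎)

  ¬bipartite⇒∣S∣≢0 : ∀ {d} (S⁻¹=S : IsInverseClosed) → ∣ S ∣ ≡ d →
                     ¬ Bipartite (cayleyGraph S⁻¹=S) → NonZero d
  ¬bipartite⇒∣S∣≢0 S⁻¹=S refl ¬bip = ℕ.≢-nonZero λ ∣S∣≡0 →
    ¬bip (⊥ , λ { (s , s∈S , _) → contradiction ∣S∣≡0
      (ℕ.n>0⇒n≢0 (ℕ.≤-<-trans ℕ.z≤n (x∈p⇒∣p-x∣<∣p∣ s∈S))) })

------------------------------------------------------------------------

k*1/k≡1 : ∀ k .{{_ : NonZero k}} → (+ k / 1) ℚ.* (+ 1 / k) ≡ 1ℚ
k*1/k≡1 k@(ℕ.suc k-1) = ℚ.toℚᵘ-injective (begin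
  ℚ.toℚᵘ ((+ k / 1) ℚ.* (+ 1 / k))
    ≈⟨ ℚ.toℚᵘ-homo-* (+ k / 1) (+ 1 / k) ⟩
  ℚ.toℚᵘ (+ k / 1) ℚᵘ.* ℚ.toℚᵘ (+ 1 / k)
    ≈⟨ ℚᵘ.*-cong (ℚ.toℚᵘ-fromℚᵘ (+ k ℚᵘ./ 1)) (ℚ.toℚᵘ-fromℚᵘ (+ 1 ℚᵘ./ k)) ⟩
  (+ k ℚᵘ./ 1) ℚᵘ.* (+ 1 ℚᵘ./ k)
    ≈⟨ ℚᵘ.*≡* (cong +_ (trans (ℕ.*-comm (k ℕ.* 1) 1) (cong (1 ℕ.*_) (ℕ.*-comm k 1)))) ⟩
  ℚᵘ.1ℚᵘ ∎)
  where open ≈-Reasoning ℚᵘ.≃-setoid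

1-kβ≢0 : ∀ k .{{_ : NonZero k}} {β} → β ℚ.< + 1 / k →
         ℚ.NonZero (1ℚ ℚ.- (+ k / 1) ℚ.* β)
1-kβ≢0 k {β} β<1/k = ℚ.≢-nonZero λ 1-kβ≡0 →
  ℚ.<⇒≢ kβ<1 (sym (x∙y⁻¹≈ε⇒x≈y 1ℚ _ 1-kβ≡0))
  where
  open GroupProperties ℚ.+-0-group using (x∙y⁻¹≈ε⇒x≈y)
  instance _ = ℚ.normalize-pos k 1
  kβ<1 : (+ k / 1) ℚ.* β ℚ.< 1ℚ
  kβ<1 = subst ((+ k / 1) ℚ.* β ℚ.<_) (k*1/k≡1 k) (ℚ.*-monoʳ-<-pos (+ k / 1) β<1/k)

{-# OPTIONS --safe #-}

-- Suppose no set is as poorly expanding as claimed, and colour L by + and R by -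
-- for an optimal pair (L , R).  For a group element g, the set of x such that gx and x
-- have the same colour has at most twice as many boundary edges as (L , R) has
-- violations, because left translations are automorphisms; so it or its complement is
-- tiny, and gx has colour χ(g) · colour(x) for most x.  The sign χ is then a
-- homomorphism, and the colouring itself is close to a right translate of ± χ.  Since the
-- graph is not bipartite, χ(s) = + for some generator s, so y and ys have equal colours
-- for most y: these are too many violations.  The argument gives h ≤ 100 β.

module Submission where

open import Defs
open import Algebra.Bundles using (Group)
open import Data.Fin.Subset using (Subset; ∣_∣)
open import Data.Integer.Base using (+_)
open import Data.Nat.Base as ℕ using (ℕ; NonZero)
open import Data.Nat.Properties using (m*n≢0)
open import Data.Rational.Base using (ℚ; _/_; 1ℚ; _-_; _*_; _÷_; _<_; _≤_)
open import Relation.Binary.PropositionalEquality using (_≡_)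
open import Relation.Nullary.Negation.Core using (¬_)

import Data.Nat.Properties as ℕ
open import Algebra.Bundles using (RawGroup)
import Algebra.Morphism.GroupMonomorphism as GroupMonomorphism
open import Algebra.Properties.CommutativeMonoid.Sum ℕ.+-0-commutativeMonoid
  using (sum; sum-cong-≗; ∑-distrib-+; ∑-comm; sum-permute)
import Algebra.Properties.Group as GroupProperties
open import Algebra.Properties.Semiring.Sum ℕ.+-*-semiring using (*-distribˡ-sum)
open import Algebra.Structures using (IsGroup)
open import Data.Bool.Base using (true; false; if_then_else_)
open import Data.Empty using (⊥)
open import Data.Fin.Base as Fin using (Fin; zero; suc)
open import Data.Fin.Permutation as Perm using (Permutation′; _⟨$⟩ʳ_)
import Data.Fin.Properties as Fin
open import Data.Fin.Subset using (_∈_; _∉_; ∁; _∪_; Nonempty; inside; outside)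
open import Data.Fin.Subset.Properties
  using (_∈?_; x∈∁p⇒x∉p; x∉p⇒x∈∁p; x∉∁p⇒x∈p; x∈p⇒x∉∁p; p⊆p∪q; q⊆p∪q; x∈p∪q⁻;
         ∣∁p∣≡n∸∣p∣; ∣p∣≤n; x∈p⇒∣p-x∣<∣p∣)
import Data.Integer.Base as ℤ
import Data.Integer.Properties as ℤ
open import Data.List.Base as List
  using (List; []; _∷_; _++_; map; length; filter; cartesianProduct; allFin)
open import Data.List.Properties using (filter-++; length-++; map-tabulate; filter-≐)
open import Data.Maybe.Base as Maybe using (Maybe; just; nothing)
import Data.Maybe.Properties as Maybe
open import Data.Nat.Base using (zero; suc; _+_; z≤n; s≤s; >-nonZero)
open import Data.Nat.Tactic.RingSolver using (solve-∀)
open import Data.Product.Base using (∃; _×_; _,_; proj₁; proj₂)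
open import Data.Rational.Base as ℚ using (0ℚ)
import Data.Rational.Properties as ℚ
import Data.Rational.Unnormalised.Base as ℚᵘ
import Data.Rational.Unnormalised.Properties as ℚᵘ
open import Data.Sign.Base as Sign using (Sign)
import Data.Sign.Properties as Sign
open import Data.Sum.Base using (_⊎_; inj₁; inj₂; [_,_]′)
open import Data.Vec.Base using (tabulate; []; _∷_)
open import Data.Vec.Properties using (lookup⇒[]=; []=⇒lookup; lookup∘tabulate)
open import Function.Base using (_∘_; id; _$_)
open import Function.Bundles using (Inverse)
open import Level using (Level)
open import Relation.Binary.PropositionalEquality
  using (_≢_; refl; sym; trans; cong; cong₂; subst; subst₂; module ≡-Reasoning)
import Relation.Binary.Reasoning.Setoid as ≈-Reasoning
open import Relation.Nullary.Decidable
  using (Dec; yes; no; does; ¬?; _×-dec_; _⊎-dec_; decidable-stable; dec-true)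
open import Relation.Nullary.Negation using (contradiction)
open import Relation.Unary using (Decidable; Pred)

private
  variable
    p q r : Level
    A P Q R : Set p
    n : ℕ

-- Counting

𝟙 : Dec P → ℕ
𝟙 P? = if does P? then 1 else 0

𝟙-yes : (P? : Dec P) → P → 1 ℕ.≤ 𝟙 P?
𝟙-yes P? x rewrite dec-true P? x = ℕ.≤-refl

𝟙-mono : (P? : Dec P) (Q? : Dec Q) → (P → Q) → 𝟙 P? ℕ.≤ 𝟙 Q?
𝟙-mono (no _)  Q? f = z≤n
𝟙-mono (yes x) Q? f = 𝟙-yes Q? (f x)

𝟙-⊎ : (P? : Dec P) (Q? : Dec Q) (R? : Dec R) → (P → Q ⊎ R) → 𝟙 P? ℕ.≤ 𝟙 Q? + 𝟙 R?
𝟙-⊎ (no _)  Q? R? f = z≤n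
𝟙-⊎ (yes x) Q? R? f with f x
... | inj₁ y = ℕ.≤-trans (𝟙-yes Q? y) (ℕ.m≤m+n _ _)
... | inj₂ z = ℕ.≤-trans (𝟙-yes R? z) (ℕ.m≤n+m _ (𝟙 Q?))

𝟙-disjoint : (P? : Dec P) (Q? : Dec Q) (R? : Dec R) →
             (P → R) → (Q → R) → (P → ¬ Q) → 𝟙 P? + 𝟙 Q? ℕ.≤ 𝟙 R?
𝟙-disjoint (no _)  Q?      R? f g d = 𝟙-mono Q? R? g
𝟙-disjoint (yes x) (no _)  R? f g d = 𝟙-yes R? (f x)
𝟙-disjoint (yes x) (yes y) R? f g d = contradiction y (d x)

sum-mono : {f g : Fin n → ℕ} → (∀ i → f i ℕ.≤ g i) → sum f ℕ.≤ sum g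
sum-mono {zero}  le = z≤n
sum-mono {suc n} le = ℕ.+-mono-≤ (le zero) (sum-mono (le ∘ suc))

sum-mono-< : .{{NonZero n}} → {f g : Fin n → ℕ} → (∀ i → f i ℕ.< g i) → sum f ℕ.< sum g
sum-mono-< {suc n} lt = ℕ.+-mono-<-≤ (lt zero) (sum-mono (ℕ.<⇒≤ ∘ lt ∘ suc))

term≤sum : (f : Fin n → ℕ) (i : Fin n) → f i ℕ.≤ sum f
term≤sum f zero    = ℕ.m≤m+n _ _
term≤sum f (suc i) = ℕ.≤-trans (term≤sum (f ∘ suc) i) (ℕ.m≤n+m _ (f zero))

sum-<⇒∃ : {f g : Fin n → ℕ} → sum f ℕ.< sum g → ∃ λ i → f i ℕ.< g i
sum-<⇒∃ {f = f} {g} lt with Fin.any? (λ i → f i ℕ.<? g i)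
... | yes ∃< = ∃<
... | no  ∄< = contradiction lt (ℕ.≤⇒≯ (sum-mono (λ i → ℕ.≮⇒≥ (∄< ∘ (i ,_)))))

sum-1 : ∀ n → sum {n} (λ _ → 1) ≡ n
sum-1 zero    = refl
sum-1 (suc n) = cong suc (sum-1 n)

count : {P : Pred (Fin n) p} → Decidable P → ℕ
count P? = sum (λ x → 𝟙 (P? x))

count₂ : {R : Fin n → Fin n → Set r} → (∀ x y → Dec (R x y)) → ℕ
count₂ R? = sum (λ x → count (R? x))

module _ {P : Pred (Fin n) p} (P? : Decidable P) where

  count-mono : {Q : Pred (Fin n) q} (Q? : Decidable Q) → (∀ {x} → P x → Q x) → count P? ℕ.≤ count Q?
  count-mono Q? f = sum-mono λ x → 𝟙-mono (P? x) (Q? x) f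

  count-⊎ : {Q : Pred (Fin n) q} (Q? : Decidable Q) {R : Pred (Fin n) r} (R? : Decidable R) →
            (∀ {x} → P x → Q x ⊎ R x) → count P? ℕ.≤ count Q? + count R?
  count-⊎ Q? R? f = ℕ.≤-trans (sum-mono λ x → 𝟙-⊎ (P? x) (Q? x) (R? x) f)
    (ℕ.≤-reflexive (∑-distrib-+ (𝟙 ∘ Q?) (𝟙 ∘ R?)))

  count-permute : (π : Permutation′ n) → count (P? ∘ (π ⟨$⟩ʳ_)) ≡ count P?
  count-permute π = sym (sum-permute (𝟙 ∘ P?) π)

-- Union bound: three sets of fewer than n / 3 points cannot cover `Fin n`. The three indicators sum
-- to less than n in total, so at some x they all vanish.
avoid₃ : {P : Pred (Fin n) p} {Q : Pred (Fin n) q} {R : Pred (Fin n) r}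
         (P? : Decidable P) (Q? : Decidable Q) (R? : Decidable R) →
         3 ℕ.* count P? ℕ.< n → 3 ℕ.* count Q? ℕ.< n → 3 ℕ.* count R? ℕ.< n →
         ∃ λ x → ¬ P x × ¬ Q x × ¬ R x
avoid₃ {n} P? Q? R? p< q< r< with sum-<⇒∃ few
  where
  #P = count P?
  #Q = count Q?
  #R = count R?
  open ℕ.≤-Reasoning
  few : sum (λ x → 𝟙 (P? x) + (𝟙 (Q? x) + 𝟙 (R? x))) ℕ.< sum {n} (λ _ → 1)
  few = ℕ.*-cancelˡ-< 3 _ _ $ begin-strict
    3 ℕ.* sum (λ x → 𝟙 (P? x) + (𝟙 (Q? x) + 𝟙 (R? x)))
      ≡⟨ cong (3 ℕ.*_) (trans (∑-distrib-+ (𝟙 ∘ P?) _)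
           (cong (#P ℕ.+_) (∑-distrib-+ (𝟙 ∘ Q?) (𝟙 ∘ R?)))) ⟩
    3 ℕ.* (#P + (#Q + #R))
      ≡⟨ trans (ℕ.*-distribˡ-+ 3 #P _) (cong (3 ℕ.* #P ℕ.+_) (ℕ.*-distribˡ-+ 3 #Q #R)) ⟩
    3 ℕ.* #P + (3 ℕ.* #Q + 3 ℕ.* #R)   <⟨ ℕ.+-mono-< p< (ℕ.+-mono-< q< r<) ⟩
    n + (n + n)                        ≡⟨ cong (λ k → n + (n + k)) (ℕ.+-identityʳ n) ⟨
    3 ℕ.* n                            ≡⟨ cong (3 ℕ.*_) (sum-1 n) ⟨
    3 ℕ.* sum {n} (λ _ → 1)            ∎
... | x , lt with P? x | Q? x | R? x
...   | no ¬p | no ¬q | no ¬r = x , ¬p , ¬q , ¬r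
...   | yes _ | _     | _     = contradiction lt λ { (s≤s ()) }
...   | no _  | yes _ | _     = contradiction lt λ { (s≤s ()) }
...   | no _  | no _  | yes _ = contradiction lt λ { (s≤s ()) }

module _ {R : Fin n → Fin n → Set r} (R? : ∀ x y → Dec (R x y)) where

  count₂-⊎ : {P : Fin n → Fin n → Set p} (P? : ∀ x y → Dec (P x y))
             {Q : Fin n → Fin n → Set q} (Q? : ∀ x y → Dec (Q x y)) →
             (∀ {x y} → R x y → P x y ⊎ Q x y) → count₂ R? ℕ.≤ count₂ P? + count₂ Q?
  count₂-⊎ P? Q? f = ℕ.≤-trans (sum-mono λ x → count-⊎ (R? x) (P? x) (Q? x) f)
    (ℕ.≤-reflexive (∑-distrib-+ (count ∘ P?) (count ∘ Q?)))

  count₂-swap : count₂ (λ x y → R? y x) ≡ count₂ R?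
  count₂-swap = ∑-comm (λ x y → 𝟙 (R? y x))

  count₂-permute : (π : Permutation′ n) → count₂ (λ x y → R? (π ⟨$⟩ʳ x) (π ⟨$⟩ʳ y)) ≡ count₂ R?
  count₂-permute π = trans (sum-cong-≗ λ x → count-permute (R? (π ⟨$⟩ʳ x)) π)
    (sym (sum-permute (count ∘ R?) π))

  count₂-disjoint : {P : Fin n → Fin n → Set p} (P? : ∀ x y → Dec (P x y))
             {Q : Fin n → Fin n → Set q} (Q? : ∀ x y → Dec (Q x y)) →
             (∀ {x y} → P x y → R x y) → (∀ {x y} → Q x y → R x y) → (∀ {x y} → P x y → ¬ Q x y) →
             count₂ P? + count₂ Q? ℕ.≤ count₂ R?
  count₂-disjoint P? Q? f g d = ℕ.≤-trans
    (ℕ.≤-reflexive (trans (sym (∑-distrib-+ (count ∘ P?) (count ∘ Q?)))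
      (sum-cong-≗ λ x → sym (∑-distrib-+ (𝟙 ∘ P? x) (𝟙 ∘ Q? x)))))
    (sum-mono λ x → sum-mono λ y → 𝟙-disjoint (P? x y) (Q? x y) (R? x y) f g d)

  -- The pairs `(x , t x)` are pairwise distinct, as x is their first entry.
  count-section : (t : Fin n → Fin n) → count (λ x → R? x (t x)) ℕ.≤ count₂ R?
  count-section t = sum-mono λ x → term≤sum (𝟙 ∘ R? x) (t x)

-- Lengths of filtered lists as counts

length-filter-∷ : {P : Pred A p} (P? : Decidable P) (x : A) (xs : List A) →
                  length (filter P? (x ∷ xs)) ≡ 𝟙 (P? x) + length (filter P? xs)
length-filter-∷ P? x xs with does (P? x)
... | true  = refl
... | false = refl

length-filter-tabulate : {P : Pred A p} (P? : Decidable P) (f : Fin n → A) →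
                         length (filter P? (List.tabulate f)) ≡ count (P? ∘ f)
length-filter-tabulate {n = zero}  P? f = refl
length-filter-tabulate {n = suc n} P? f = trans (length-filter-∷ P? (f zero) _)
  (cong (_ ℕ.+_) (length-filter-tabulate P? (f ∘ suc)))

length-filter-pairs : {P : Pred (Fin n × Fin n) p} (P? : Decidable P) →
  length (filter P? (cartesianProduct (allFin n) (allFin n))) ≡ count₂ (λ x y → P? (x , y))
length-filter-pairs {n} P? = go id
  where
  open ≡-Reasoning
  go : ∀ {m} (f : Fin m → Fin n) →
       length (filter P? (cartesianProduct (List.tabulate f) (allFin n))) ≡
       sum (λ x → sum (λ y → 𝟙 (P? (f x , y))))
  go {zero}  f = refl
  go {suc m} f = begin
    length (filter P? (map (f zero ,_) (allFin n) ++ rest))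
      ≡⟨ trans (cong length (filter-++ P? (map (f zero ,_) (allFin n)) rest))
               (length-++ (filter P? (map (f zero ,_) (allFin n)))) ⟩
    length (filter P? (map (f zero ,_) (allFin n))) + length (filter P? rest)
      ≡⟨ cong₂ _+_ (trans (cong (length ∘ filter P?) (map-tabulate id (f zero ,_)))
                          (length-filter-tabulate P? (f zero ,_)))
                   (go (f ∘ suc)) ⟩
    sum (λ x → sum (λ y → 𝟙 (P? (f x , y)))) ∎
    where rest = cartesianProduct (List.tabulate (f ∘ suc)) (allFin n)

filter-filter : {P : Pred A p} (P? : Decidable P) {Q : Pred A q} (Q? : Decidable Q) (xs : List A) →
                filter Q? (filter P? xs) ≡ filter (λ x → P? x ×-dec Q? x) xs
filter-filter P? Q? []       = refl
filter-filter P? Q? (x ∷ xs) with does (P? x)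
... | false = filter-filter P? Q? xs
... | true  with does (Q? x)
...   | false = filter-filter P? Q? xs
...   | true  = cong (x ∷_) (filter-filter P? Q? xs)

∣p∣≡count : (A : Subset n) → ∣ A ∣ ≡ count (_∈? A)
∣p∣≡count []            = refl
∣p∣≡count (inside  ∷ A) = cong suc (∣p∣≡count A)
∣p∣≡count (outside ∷ A) = ∣p∣≡count A

⟪_⟫ : {P : Pred (Fin n) p} → Decidable P → Subset n
⟪ P? ⟫ = tabulate (does ∘ P?)

module _ {P : Pred (Fin n) p} (P? : Decidable P) where

  ∈⟪⟫⁺ : ∀ {x} → P x → x ∈ ⟪ P? ⟫
  ∈⟪⟫⁺ {x} px = lookup⇒[]= x _ (trans (lookup∘tabulate _ x) (dec-true (P? x) px))

  ∈⟪⟫⁻ : ∀ {x} → x ∈ ⟪ P? ⟫ → P x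
  ∈⟪⟫⁻ {x} x∈ with P? x | trans (sym (lookup∘tabulate (does ∘ P?) x)) ([]=⇒lookup x∈)
  ... | yes px | _ = px

-- Edge boundaries

module _ (G : Graph n) where
  open Graph G

  cut? : (A : Subset n) → ∀ x y → Dec (Adj x y × x ∈ A × y ∉ A)
  cut? A x y = adj? x y ×-dec (x ∈? A) ×-dec ¬? (y ∈? A)

  private
    -- `∂` lists an edge once, smaller endpoint first; `cut?` admits it once, endpoint in `A` first.
    -- `up?` and `down?` sort the cut pairs by whether the two orientations coincide.
    up? : (A : Subset n) → ∀ x y → Dec (x Fin.≤ y × Adj x y × x ∈ A × y ∉ A)
    up? A x y = (x Fin.≤? y) ×-dec cut? A x y

    down? : (A : Subset n) → ∀ x y → Dec (y Fin.≤ x × Adj x y × x ∈ A × y ∉ A)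
    down? A x y = (y Fin.≤? x) ×-dec cut? A x y

    ∂? : (A : Subset n) → ∀ x y →
         Dec ((x Fin.≤ y × Adj x y) × ((x ∈ A × y ∉ A) ⊎ (x ∉ A × y ∈ A)))
    ∂? A x y = ((x Fin.≤? y) ×-dec adj? x y) ×-dec
      (((x ∈? A) ×-dec ¬? (y ∈? A)) ⊎-dec (¬? (x ∈? A) ×-dec (y ∈? A)))

    length-∂ : (A : Subset n) → length (∂ G A) ≡ count₂ (∂? A)
    length-∂ A = trans (cong length (filter-filter _ _ (pairs G)))
      (length-filter-pairs (λ (x , y) → ∂? A x y))

  -- Each pair in `∂ G A` is an upward cut pair or the reversal of a downward one. A cut pair that
  -- was both would be a loop, with its vertex both in `A` and outside.
  length-∂≤cut : (A : Subset n) → length (∂ G A) ℕ.≤ count₂ (cut? A)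
  length-∂≤cut A = begin
    length (∂ G A)                                 ≡⟨ length-∂ A ⟩
    count₂ (∂? A)                                  ≤⟨ count₂-⊎ (∂? A) (up? A) (λ x y → down? A y x) (λ
      { ((x≤y , adj) , inj₁ (x∈ , y∉)) → inj₁ (x≤y , adj , x∈ , y∉)
      ; ((x≤y , adj) , inj₂ (x∉ , y∈)) → inj₂ (x≤y , adj-sym adj , y∈ , x∉) }) ⟩
    count₂ (up? A) + count₂ (λ x y → down? A y x)  ≡⟨ cong (count₂ (up? A) ℕ.+_) (count₂-swap (down? A)) ⟩
    count₂ (up? A) + count₂ (down? A)              ≤⟨ count₂-disjoint (cut? A) (up? A) (down? A) proj₂ proj₂
      (λ { (x≤y , _ , x∈ , y∉) (y≤x , _) → y∉ (subst (_∈ A) (Fin.≤-antisym x≤y y≤x) x∈) }) ⟩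
    count₂ (cut? A)                                ∎
    where open ℕ.≤-Reasoning

  -- Upward pairs and reversed downward pairs are listed edges, and they differ in which endpoint
  -- lies in `A`, so no edge is used twice.
  cut≤length-∂ : (A : Subset n) → count₂ (cut? A) ℕ.≤ length (∂ G A)
  cut≤length-∂ A = begin
    count₂ (cut? A)                                ≤⟨ count₂-⊎ (cut? A) (up? A) (down? A) (λ {x} {y} c →
      [ (λ x≤y → inj₁ (x≤y , c)) , (λ y≤x → inj₂ (y≤x , c)) ]′ (Fin.≤-total x y)) ⟩
    count₂ (up? A) + count₂ (down? A)              ≡⟨ cong (count₂ (up? A) ℕ.+_) (count₂-swap (down? A)) ⟨
    count₂ (up? A) + count₂ (λ x y → down? A y x)  ≤⟨ count₂-disjoint (∂? A) (up? A) (λ x y → down? A y x)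
      (λ { (x≤y , adj , c) → (x≤y , adj) , inj₁ c })
      (λ { (x≤y , adj , y∈ , x∉) → (x≤y , adj-sym adj) , inj₂ (x∉ , y∈) })
      (λ { (_ , _ , x∈ , _) (_ , _ , _ , x∉) → x∉ x∈ }) ⟩
    count₂ (∂? A)                                  ≡⟨ length-∂ A ⟨
    length (∂ G A)                                 ∎
    where open ℕ.≤-Reasoning

  ∂-∁ : (A : Subset n) → ∂ G (∁ A) ≡ ∂ G A
  ∂-∁ A = filter-≐ _ _
    ( (λ { (inj₁ (x∈ , y∉)) → inj₂ (x∈∁p⇒x∉p x∈ , x∉∁p⇒x∈p y∉)
         ; (inj₂ (x∉ , y∈)) → inj₁ (x∉∁p⇒x∈p x∉ , x∈∁p⇒x∉p y∈) })
    , (λ { (inj₁ (x∈ , y∉)) → inj₂ (x∈p⇒x∉∁p x∈ , x∉p⇒x∈∁p y∉)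
         ; (inj₂ (x∉ , y∈)) → inj₁ (x∉p⇒x∈∁p x∉ , x∈p⇒x∉∁p y∈) }))
    (edges G)

-- Partial 2-colourings

-- `v ≢ nothing` is needed because `Maybe.map` would let two uncoloured points agree.
Agree : Sign → Maybe Sign → Maybe Sign → Set
Agree σ v w = v ≢ nothing × w ≡ Maybe.map (σ Sign.*_) v

-- Not symmetric: summed over ordered pairs, an edge leaving the coloured part counts once,
-- as in ∂, and an edge inside a colour class counts as it does in e.
Clash : Maybe Sign → Maybe Sign → Set
Clash v w = v ≢ nothing × w ≢ Maybe.map (Sign.- Sign.*_) v

_≟ᵐ_ : (v w : Maybe Sign) → Dec (v ≡ w)
_≟ᵐ_ = Maybe.≡-dec Sign._≟_

agree? : ∀ σ v w → Dec (Agree σ v w)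
agree? σ v w = ¬? (v ≟ᵐ nothing) ×-dec (w ≟ᵐ Maybe.map (σ Sign.*_) v)

clash? : ∀ v w → Dec (Clash v w)
clash? v w = ¬? (v ≟ᵐ nothing) ×-dec ¬? (w ≟ᵐ Maybe.map (Sign.- Sign.*_) v)

-- Read v, v′, w, w′ as the colours of x, gx, y, gy for an edge xy. If neither xy nor its translate
-- clashes, then w = - v and w′ = - v′, so agreement passes from x to y.
agree⇒clash : ∀ {v v′ w w′} → Agree Sign.+ v v′ → ¬ Agree Sign.+ w w′ → Clash v w ⊎ Clash v′ w′
agree⇒clash {nothing} (v≢∅ , _) _ = contradiction refl v≢∅
agree⇒clash {just t} {w = w} (v≢∅ , refl) ¬agree with w ≟ᵐ just (Sign.- Sign.* t)
... | no  w≢   = inj₁ (v≢∅ , w≢)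
... | yes refl = inj₂ (v≢∅ , λ w′≡ → ¬agree ((λ ()) , w′≡))

-- Both signs take v to u, and the sign of v cancels. This is what makes χ multiplicative.
agree-∘ : ∀ {σ τ ρ v w u} → Agree σ v w → Agree τ w u → Agree ρ v u → ρ ≡ τ Sign.* σ
agree-∘ {v = nothing} (v≢∅ , _) _ _ = contradiction refl v≢∅
agree-∘ {σ} {τ} {ρ} {v = just t} (_ , refl) (_ , refl) (_ , eq) =
  Sign.*-cancelʳ-≡ t ρ (τ Sign.* σ)
    (trans (sym (Maybe.just-injective eq)) (sym (Sign.*-assoc τ σ t)))

-- Here w and w′ are the same sign τ v, and no sign is its own opposite.
agree²⇒clash : ∀ {τ v w w′} → Agree τ v w → Agree τ v w′ → Clash w w′
agree²⇒clash {v = nothing} (v≢∅ , _) _ = contradiction refl v≢∅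
agree²⇒clash {τ} {v = just t} (_ , refl) (_ , refl) =
  (λ ()) , Sign.s≢opposite[s] (τ Sign.* t) ∘ Maybe.just-injective

-- There are only two signs, so coloured values that are not opposite are equal.
¬agree : ∀ {v w} → ¬ Agree Sign.- v w → Agree Sign.+ v w ⊎ (v ≡ nothing ⊎ w ≡ nothing)
¬agree {nothing}                     _ = inj₂ (inj₁ refl)
¬agree {just _}       {nothing}      _ = inj₂ (inj₂ refl)
¬agree {just Sign.+ } {just Sign.+ } _ = inj₁ ((λ ()) , refl)
¬agree {just Sign.- } {just Sign.- } _ = inj₁ ((λ ()) , refl)
¬agree {just Sign.+ } {just Sign.- } f = contradiction ((λ ()) , refl) f
¬agree {just Sign.- } {just Sign.+ } f = contradiction ((λ ()) , refl) f

*-≢+ : ∀ σ τ → τ ≢ Sign.+ → σ Sign.* τ ≡ Sign.opposite σ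
*-≢+ σ Sign.+ τ≢+ = contradiction refl τ≢+
*-≢+ σ Sign.- _   = Sign.*-comm σ Sign.-

alternating⇒bipartite : (G : Graph n) (χ : Fin n → Sign) →
  (∀ {x y} → Graph.Adj G x y → χ y ≡ Sign.opposite (χ x)) → Bipartite G
alternating⇒bipartite G χ alternating = ⟪ positive? ⟫ , λ {x} adj → separates (χ x) refl (alternating adj)
  where
  positive? : Decidable (λ x → χ x ≡ Sign.+)
  positive? x = χ x Sign.≟ Sign.+

  separates : ∀ {x y} σ → χ x ≡ σ → χ y ≡ Sign.opposite (χ x) →
    (x ∈ ⟪ positive? ⟫ × y ∉ ⟪ positive? ⟫) ⊎ (x ∉ ⟪ positive? ⟫ × y ∈ ⟪ positive? ⟫)
  separates Sign.+ χx≡ χy≡ = inj₁ (∈⟪⟫⁺ positive? χx≡ , λ y∈ →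
    contradiction (trans (sym (∈⟪⟫⁻ positive? y∈)) (trans χy≡ (cong Sign.opposite χx≡))) λ ())
  separates Sign.- χx≡ χy≡ =
    inj₂ ((λ x∈ → contradiction (trans (sym (∈⟪⟫⁻ positive? x∈)) χx≡) λ ()) ,
          ∈⟪⟫⁺ positive? (trans χy≡ (cong Sign.opposite χx≡)))

-- Left-invariant graphs on a finite group

module LeftInvariant
  (G : Graph n) (S : Subset n)
  {_·_ : Fin n → Fin n → Fin n} {ε : Fin n} {_⁻¹ : Fin n → Fin n}
  (isGroup : IsGroup _≡_ _·_ ε _⁻¹)
  (adj⁻ : ∀ {x y} → Graph.Adj G x y → ∃ λ s → s ∈ S × x · s ≡ y)
  (adj⁺ : ∀ {s} x → s ∈ S → Graph.Adj G x (x · s))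
  where
  open Graph G
  open IsGroup isGroup using (assoc; _//_)

  group : Group _ _
  group = record { isGroup = isGroup }

  open GroupProperties group

  -- Edges are right multiplications by elements of `S`, and by associativity these commute with
  -- left multiplications.
  adj-· : ∀ g {x y} → Adj x y → Adj (g · x) (g · y)
  adj-· g {x} adj with s , s∈S , refl ← adj⁻ adj = subst (Adj _) (assoc g x s) (adj⁺ (g · x) s∈S)

  lmul rmul : Fin n → Permutation′ n
  lmul g = Perm.permutation (g ·_) (g ⁻¹ ·_) (\\-leftDividesˡ g) (\\-leftDividesʳ g)
  rmul g = Perm.permutation (_· g) (_// g) (//-rightDividesˡ g) (//-rightDividesʳ g)

  module _
    .{{_ : NonZero n}} (¬bip : ¬ Bipartite G)
    (f : Fin n → Maybe Sign) (U : Subset n) (uncoloured : ∀ {x} → f x ≡ nothing → x ∉ U)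
    (E : ℕ) (16E<∣U∣ : 16 ℕ.* E ℕ.< ∣ U ∣)
    (∂U≤E : length (∂ G U) ℕ.≤ E)
    (clashes≤E : count₂ (λ x y → adj? x y ×-dec clash? (f x) (f y)) ℕ.≤ E)
    -- For E the violations of (L , R) and U = L ∪ R, this says that the expansion of A exceeds 100
    -- b(L , R), with the factor d cancelled and the denominators cleared.
    (expanding : ∀ A → 0 ℕ.< ∣ A ∣ → 2 ℕ.* ∣ A ∣ ℕ.≤ n →
                 100 ℕ.* (E ℕ.* ∣ A ∣) ℕ.< ∣ U ∣ ℕ.* length (∂ G A))
    where

    private
      m = ∣ U ∣
      instance m≢0 : NonZero m
      m≢0 = >-nonZero (ℕ.≤-<-trans z≤n 16E<∣U∣)

    -- Together with the bound on the boundary, `expanding` gives 100 E |A| < k m E. Strictness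
    -- rules out E = 0, so E cancels.
    small-half : ∀ k .{{_ : NonZero k}} A → length (∂ G A) ℕ.≤ k ℕ.* E → 2 ℕ.* ∣ A ∣ ℕ.≤ n →
                 100 ℕ.* ∣ A ∣ ℕ.< k ℕ.* m
    small-half k A ∂A≤ 2∣A∣≤n with 0 ℕ.<? ∣ A ∣
    -- `expanding` speaks of nonempty sets only; for empty A the claim is 0 < k m.
    ... | no  ≮ = subst (λ a → 100 ℕ.* a ℕ.< k ℕ.* m) (sym (ℕ.n≤0⇒n≡0 (ℕ.≮⇒≥ ≮)))
                    (ℕ.>-nonZero⁻¹ (k ℕ.* m) {{m*n≢0 k m}})
    ... | yes 0<∣A∣ = ℕ.*-cancelˡ-< E _ _ $ begin-strict
      E ℕ.* (100 ℕ.* ∣ A ∣)    ≡⟨ assoc₁ E ∣ A ∣ ⟩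
      100 ℕ.* (E ℕ.* ∣ A ∣)    <⟨ expanding A 0<∣A∣ 2∣A∣≤n ⟩
      m ℕ.* length (∂ G A)     ≤⟨ ℕ.*-monoʳ-≤ m ∂A≤ ⟩
      m ℕ.* (k ℕ.* E)          ≡⟨ assoc₂ m k E ⟩
      E ℕ.* (k ℕ.* m)          ∎
      where
      open ℕ.≤-Reasoning
      assoc₁ : ∀ x y → x ℕ.* (100 ℕ.* y) ≡ 100 ℕ.* (x ℕ.* y)
      assoc₁ = solve-∀
      assoc₂ : ∀ x y z → x ℕ.* (y ℕ.* z) ≡ z ℕ.* (y ℕ.* x)
      assoc₂ = solve-∀

    -- A set and its complement have the same boundary, and one of them has at most half of the
    -- points.
    small-or-cosmall : ∀ k .{{_ : NonZero k}} A → length (∂ G A) ℕ.≤ k ℕ.* E →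
                       100 ℕ.* ∣ A ∣ ℕ.< k ℕ.* m ⊎ 100 ℕ.* ∣ ∁ A ∣ ℕ.< k ℕ.* m
    small-or-cosmall k A ∂A≤ with 2 ℕ.* ∣ A ∣ ℕ.≤? n
    ... | yes le = inj₁ (small-half k A ∂A≤ le)
    ... | no  ≰  = inj₂ (small-half k (∁ A) (subst (ℕ._≤ _) (cong length (sym (∂-∁ G A))) ∂A≤) $ begin
      2 ℕ.* ∣ ∁ A ∣                ≡⟨ cong (2 ℕ.*_) (∣∁p∣≡n∸∣p∣ A) ⟩
      2 ℕ.* (n ℕ.∸ ∣ A ∣)          ≡⟨ ℕ.*-distribˡ-∸ 2 n ∣ A ∣ ⟩
      2 ℕ.* n ℕ.∸ 2 ℕ.* ∣ A ∣      ≤⟨ ℕ.∸-monoʳ-≤ (2 ℕ.* n) (ℕ.≰⇒≥ ≰) ⟩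
      2 ℕ.* n ℕ.∸ n                ≡⟨ ℕ.m+n∸m≡n n (n + 0) ⟩
      n + 0                        ≡⟨ ℕ.+-identityʳ n ⟩
      n                            ∎)
      where open ℕ.≤-Reasoning

    -- The dichotomy applies to U with k = 1, and U itself cannot be the small side: that would mean
    -- 100 m < m.
    ∁U-small : 100 ℕ.* ∣ ∁ U ∣ ℕ.< m
    ∁U-small with small-or-cosmall 1 U (subst (_ ℕ.≤_) (sym (ℕ.*-identityˡ E)) ∂U≤E)
    ... | inj₁ lt = contradiction (subst (100 ℕ.* m ℕ.<_) (ℕ.*-identityˡ m) lt) (ℕ.≤⇒≯ (ℕ.m≤n*m m 100))
    ... | inj₂ lt = subst (100 ℕ.* ∣ ∁ U ∣ ℕ.<_) (ℕ.*-identityˡ m) lt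

    -- The sign of a left translation

    module Translate (g : Fin n) where

      agreeing? : Decidable (λ x → Agree Sign.+ (f x) (f (g · x)))
      agreeing? x = agree? Sign.+ (f x) (f (g · x))

      clash₂? : ∀ x y → Dec (Adj x y × Clash (f x) (f y))
      clash₂? x y = adj? x y ×-dec clash? (f x) (f y)

      -- A pair leaving the agreeing set clashes, or its translate by g does. Translation permutes
      -- the adjacent pairs, so each alternative accounts for at most E of them.
      ∂-agreeing : length (∂ G ⟪ agreeing? ⟫) ℕ.≤ 2 ℕ.* E
      ∂-agreeing = begin
        length (∂ G ⟪ agreeing? ⟫)       ≤⟨ length-∂≤cut G ⟪ agreeing? ⟫ ⟩
        count₂ (cut? G ⟪ agreeing? ⟫)    ≤⟨ count₂-⊎ (cut? G ⟪ agreeing? ⟫) clash₂?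
          (λ x y → clash₂? (g · x) (g · y)) (λ { (adj , x∈ , y∉) →
            [ (λ c → inj₁ (adj , c)) , (λ c → inj₂ (adj-· g adj , c)) ]′
              (agree⇒clash (∈⟪⟫⁻ agreeing? x∈) (y∉ ∘ ∈⟪⟫⁺ agreeing?)) }) ⟩
        count₂ clash₂? + count₂ (λ x y → clash₂? (g · x) (g · y))
          ≡⟨ cong (count₂ clash₂? ℕ.+_) (count₂-permute clash₂? (lmul g)) ⟩
        count₂ clash₂? + count₂ clash₂?  ≤⟨ ℕ.+-mono-≤ clashes≤E clashes≤E ⟩
        E + E                            ≡⟨ cong (E ℕ.+_) (ℕ.+-identityʳ E) ⟨
        2 ℕ.* E                          ∎
        where open ℕ.≤-Reasoning

      err? : ∀ σ → Decidable (λ x → ¬ Agree σ (f x) (f (g · x)))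
      err? σ x = ¬? (agree? σ (f x) (f (g · x)))

      ∣∁U∣≡ : count (λ x → g · x ∈? ∁ U) ≡ ∣ ∁ U ∣
      ∣∁U∣≡ = trans (count-permute (_∈? ∁ U) (lmul g)) (sym (∣p∣≡count (∁ U)))

      -- The dichotomy leaves at most 4 m / 100 errors; since m ≤ n, this is below n / 3, the
      -- threshold of `avoid₃`.
      few-errors : ∀ e → 100 ℕ.* e ℕ.< 4 ℕ.* m → 3 ℕ.* e ℕ.< n
      few-errors e lt = ℕ.*-cancelˡ-< 4 _ _ $ begin-strict
        4 ℕ.* (3 ℕ.* e)  ≡⟨ ℕ.*-assoc 4 3 e ⟨
        12 ℕ.* e         ≤⟨ ℕ.*-monoˡ-≤ e (ℕ.m≤m+n 12 88) ⟩
        100 ℕ.* e        <⟨ lt ⟩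
        4 ℕ.* m          ≤⟨ ℕ.*-monoʳ-≤ 4 (∣p∣≤n U) ⟩
        4 ℕ.* n          ∎
        where open ℕ.≤-Reasoning

      character : ∃ λ σ → 3 ℕ.* count (err? σ) ℕ.< n
      character with small-or-cosmall 2 ⟪ agreeing? ⟫ ∂-agreeing
      ... | inj₂ lt = Sign.+ , few-errors (count (err? Sign.+)) (begin-strict
        100 ℕ.* count (err? Sign.+)      ≤⟨ ℕ.*-monoʳ-≤ 100 (count-mono (err? Sign.+) (_∈? ∁ ⟪ agreeing? ⟫)
                                              (λ ¬ag → x∉p⇒x∈∁p (¬ag ∘ ∈⟪⟫⁻ agreeing?))) ⟩
        100 ℕ.* count (_∈? ∁ ⟪ agreeing? ⟫) ≡⟨ cong (100 ℕ.*_) (∣p∣≡count (∁ ⟪ agreeing? ⟫)) ⟨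
        100 ℕ.* ∣ ∁ ⟪ agreeing? ⟫ ∣      <⟨ lt ⟩
        2 ℕ.* m                          ≤⟨ ℕ.*-monoˡ-≤ m (ℕ.m≤m+n 2 2) ⟩
        4 ℕ.* m                          ∎)
        where open ℕ.≤-Reasoning
      -- A point whose colour is not reversed is agreeing, or it or its translate lies outside `U`.
      -- Times 100, these contribute less than 2 m, m and m, whence the 4 m.
      ... | inj₁ lt = Sign.- , few-errors (count (err? Sign.-)) (begin-strict
        100 ℕ.* count (err? Sign.-)      ≤⟨ ℕ.*-monoʳ-≤ 100 (count-⊎ (err? Sign.-) (_∈? ⟪ agreeing? ⟫)
            (λ x → (x ∈? ∁ U) ⊎-dec (g · x ∈? ∁ U))
            (λ ¬ag → [ inj₁ ∘ ∈⟪⟫⁺ agreeing? ,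
                       inj₂ ∘ [ inj₁ ∘ x∉p⇒x∈∁p ∘ uncoloured , inj₂ ∘ x∉p⇒x∈∁p ∘ uncoloured ]′ ]′
                       (¬agree ¬ag))) ⟩
        100 ℕ.* (count (_∈? ⟪ agreeing? ⟫) + count (λ x → (x ∈? ∁ U) ⊎-dec (g · x ∈? ∁ U)))
          ≤⟨ ℕ.*-monoʳ-≤ 100 (ℕ.+-monoʳ-≤ (count (_∈? ⟪ agreeing? ⟫))
               (count-⊎ (λ x → (x ∈? ∁ U) ⊎-dec (g · x ∈? ∁ U)) (_∈? ∁ U) (λ x → g · x ∈? ∁ U) id)) ⟩
        100 ℕ.* (count (_∈? ⟪ agreeing? ⟫) + (count (_∈? ∁ U) + count (λ x → g · x ∈? ∁ U)))
          ≡⟨ cong (100 ℕ.*_) (cong₂ _+_ (sym (∣p∣≡count ⟪ agreeing? ⟫))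
               (cong₂ _+_ (sym (∣p∣≡count (∁ U))) ∣∁U∣≡)) ⟩
        100 ℕ.* (∣ ⟪ agreeing? ⟫ ∣ + (∣ ∁ U ∣ + ∣ ∁ U ∣))
          ≡⟨ distrib (∣ ⟪ agreeing? ⟫ ∣) (∣ ∁ U ∣) (∣ ∁ U ∣) ⟩
        100 ℕ.* ∣ ⟪ agreeing? ⟫ ∣ + (100 ℕ.* ∣ ∁ U ∣ + 100 ℕ.* ∣ ∁ U ∣)
          <⟨ ℕ.+-mono-< lt (ℕ.+-mono-< ∁U-small ∁U-small) ⟩
        2 ℕ.* m + (m + m)                ≡⟨ double m ⟩
        4 ℕ.* m                          ∎)
        where
        open ℕ.≤-Reasoning
        distrib : ∀ x y z → 100 ℕ.* (x + (y + z)) ≡ 100 ℕ.* x + (100 ℕ.* y + 100 ℕ.* z)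
        distrib = solve-∀
        double : ∀ x → 2 ℕ.* x + (x + x) ≡ 4 ℕ.* x
        double = solve-∀

    open Translate using (err?; character)

    -- The sign character χ

    module Character (χ : Fin n → Sign) (χ-errors : ∀ g → 3 ℕ.* count (err? g (χ g)) ℕ.< n) where

      χ-errors-· : ∀ g h → 3 ℕ.* count (λ x → err? g (χ g) (h · x)) ℕ.< n
      χ-errors-· g h = subst (λ k → 3 ℕ.* k ℕ.< n)
        (sym (count-permute (err? g (χ g)) (lmul h))) (χ-errors g)

      -- At an x outside three error sets, the colour of ghx arises from that of x in two ways:
      -- through hx, by χ h and then χ g, and directly, by `χ (g · h)`.
      χ-homo : ∀ g h → χ (g · h) ≡ χ g Sign.* χ h
      χ-homo g h = agree-∘ {χ h} {χ g}
        (decidable-stable (agree? (χ h) (f x) (f (h · x))) (proj₁ (proj₂ common)))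
        (decidable-stable (agree? (χ g) (f (h · x)) (f (g · (h · x)))) (proj₁ (proj₂ (proj₂ common))))
        (subst (λ y → Agree (χ (g · h)) (f x) (f y)) (assoc g h x)
          (decidable-stable (agree? (χ (g · h)) (f x) (f ((g · h) · x))) (proj₂ (proj₂ (proj₂ common)))))
        where
        common = avoid₃ (err? h (χ h)) (λ x → err? g (χ g) (h · x)) (err? (g · h) (χ (g · h)))
          (χ-errors h) (χ-errors-· g h) (χ-errors (g · h))
        x = proj₁ common

      -- Averaging: each g errs at fewer than n / 3 points, so some point is an error of fewer than
      -- n / 3 elements g.
      typical-point : ∃ λ x → 3 ℕ.* count (λ g → err? g (χ g) x) ℕ.< n
      typical-point = sum-<⇒∃ $ begin-strict
        sum (λ x → 3 ℕ.* count (λ g → err? g (χ g) x))  ≡⟨ *-distribˡ-sum 3 (λ x → count (λ g → err? g (χ g) x)) ⟨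
        3 ℕ.* count₂ (λ x g → err? g (χ g) x)           ≡⟨ cong (3 ℕ.*_) (count₂-swap (λ g x → err? g (χ g) x)) ⟩
        3 ℕ.* count₂ (λ g x → err? g (χ g) x)           ≡⟨ *-distribˡ-sum 3 (λ g → count (err? g (χ g))) ⟩
        sum (λ g → 3 ℕ.* count (err? g (χ g)))          <⟨ sum-mono-< χ-errors ⟩
        sum {n} (λ _ → n)                               ∎
        where open ℕ.≤-Reasoning

      flip : ∀ {x s} → χ s ≢ Sign.+ → χ (x · s) ≡ Sign.opposite (χ x)
      flip {x} {s} χs≢+ = trans (χ-homo x s) (*-≢+ (χ x) (χ s) χs≢+)

      negative⇒bipartite : (∀ {s} → s ∈ S → χ s ≢ Sign.+) → Bipartite G
      negative⇒bipartite negative = alternating⇒bipartite G χ λ adj →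
        let s , s∈S , x·s≡y = adj⁻ adj in
        trans (cong χ (sym x·s≡y)) (flip (negative s∈S))

      module _ (x₀ : Fin n) (typical : 3 ℕ.* count (λ g → err? g (χ g) x₀) ℕ.< n)
               (s : Fin n) (s∈S : s ∈ S) (χs≡+ : χ s ≡ Sign.+) where

        -- Writing y = g x₀ with g = y x₀⁻¹, the predicted colour of y is χ g times that of x₀;
        -- deviants are the y that miss it.
        deviant? : Decidable (λ y → ¬ Agree (χ (y // x₀)) (f x₀) (f y))
        deviant? y = ¬? (agree? (χ (y // x₀)) (f x₀) (f y))

        clash-s? : Decidable (λ y → Clash (f y) (f (y · s)))
        clash-s? y = clash? (f y) (f (y · s))

        -- The bijection taking g to g x₀ matches the elements that err at x₀ with the deviants.
        few-deviants : 3 ℕ.* count deviant? ℕ.< n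
        few-deviants = begin-strict
          3 ℕ.* count deviant?                  ≡⟨ cong (3 ℕ.*_) (count-permute deviant? (rmul x₀)) ⟨
          3 ℕ.* count (λ g → deviant? (g · x₀)) ≤⟨ ℕ.*-monoʳ-≤ 3 (count-mono
               (λ g → deviant? (g · x₀)) (λ g → err? g (χ g) x₀)
               (λ {g} → subst (λ h → ¬ Agree (χ h) (f x₀) (f (g · x₀))) (//-rightDividesʳ x₀ g))) ⟩
          3 ℕ.* count (λ g → err? g (χ g) x₀)   <⟨ typical ⟩
          n                                     ∎
          where open ℕ.≤-Reasoning

        -- The adjacent pairs (y , ys) are distinct for distinct y, so at most E of them clash; and
        -- 3 E ≤ 16 E < m ≤ n.
        few-clashes : 3 ℕ.* count clash-s? ℕ.< n
        few-clashes = begin-strict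
          3 ℕ.* count clash-s?  ≤⟨ ℕ.*-monoʳ-≤ 3 (count-mono clash-s? (λ y → adj? y (y · s) ×-dec clash-s? y)
                                     (adj⁺ _ s∈S ,_)) ⟩
          3 ℕ.* count (λ y → adj? y (y · s) ×-dec clash-s? y)
                                ≤⟨ ℕ.*-monoʳ-≤ 3 (count-section (λ x y → adj? x y ×-dec clash? (f x) (f y)) (_· s)) ⟩
          3 ℕ.* count₂ (λ x y → adj? x y ×-dec clash? (f x) (f y)) ≤⟨ ℕ.*-monoʳ-≤ 3 clashes≤E ⟩
          3 ℕ.* E               ≤⟨ ℕ.*-monoˡ-≤ E (ℕ.m≤m+n 3 13) ⟩
          16 ℕ.* E              <⟨ 16E<∣U∣ ⟩
          m                     ≤⟨ ∣p∣≤n U ⟩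
          n                     ∎
          where open ℕ.≤-Reasoning

        χ-·s : ∀ y → χ ((y · s) // x₀) ≡ χ (y // x₀)
        χ-·s y = begin
          χ ((y · s) // x₀)                       ≡⟨ χ-homo (y · s) (x₀ ⁻¹) ⟩
          χ (y · s) Sign.* χ (x₀ ⁻¹)              ≡⟨ cong (Sign._* χ (x₀ ⁻¹)) (χ-homo y s) ⟩
          (χ y Sign.* χ s) Sign.* χ (x₀ ⁻¹)       ≡⟨ cong (λ σ → (χ y Sign.* σ) Sign.* χ (x₀ ⁻¹)) χs≡+ ⟩
          (χ y Sign.* Sign.+) Sign.* χ (x₀ ⁻¹)    ≡⟨ cong (Sign._* χ (x₀ ⁻¹)) (Sign.*-identityʳ (χ y)) ⟩
          χ y Sign.* χ (x₀ ⁻¹)                    ≡⟨ χ-homo y (x₀ ⁻¹) ⟨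
          χ (y // x₀)                             ∎
          where open ≡-Reasoning

        few-deviants-·s : 3 ℕ.* count (λ y → deviant? (y · s)) ℕ.< n
        few-deviants-·s = subst (λ k → 3 ℕ.* k ℕ.< n) (sym (count-permute deviant? (rmul s))) few-deviants

        -- Some y avoids three exceptional sets: neither y nor ys is deviant, and they do not clash.
        -- But by `χ-·s` both have the same predicted colour, which is a clash.
        no-positive-generator : ⊥
        no-positive-generator = ¬clash (agree²⇒clash {χ (y // x₀)}
            (decidable-stable (agree? (χ (y // x₀)) (f x₀) (f y)) ¬¬p)
            (subst (λ σ → Agree σ (f x₀) (f (y · s))) (χ-·s y)
              (decidable-stable (agree? (χ ((y · s) // x₀)) (f x₀) (f (y · s))) ¬¬q)))
          where
          common = avoid₃ deviant? (λ y → deviant? (y · s)) clash-s? few-deviants few-deviants-·s few-clashes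
          y      = proj₁ common
          ¬¬p    = proj₁ (proj₂ common)
          ¬¬q    = proj₁ (proj₂ (proj₂ common))
          ¬clash = proj₂ (proj₂ (proj₂ common))

      absurd : ⊥
      absurd = ¬bip (negative⇒bipartite λ s∈S χs≡+ →
        no-positive-generator (proj₁ typical-point) (proj₂ typical-point) _ s∈S χs≡+)

    ¬expanding : ⊥
    ¬expanding = Character.absurd (proj₁ ∘ character) (proj₂ ∘ character)

-- The colouring given by a pair (L , R)

module _ (G : Graph n) (L R : Subset n) where
  open Graph G

  -- The decisions are arguments so that a case split on the membership tests computes the colour.
  pick : ∀ {x} → Dec (x ∈ L) → Dec (x ∈ R) → Maybe Sign
  pick (yes _) _       = just Sign.+
  pick (no _)  (yes _) = just Sign.-
  pick (no _)  (no _)  = nothing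

  colour : Fin n → Maybe Sign
  colour x = pick (x ∈? L) (x ∈? R)

  uncoloured⇒∉ : ∀ {x} → colour x ≡ nothing → x ∉ L ∪ R
  uncoloured⇒∉ {x} eq x∈ with x ∈? L | x ∈? R | x∈p∪q⁻ L R x∈
  ... | no x∉L | no x∉R | inj₁ x∈L = x∉L x∈L
  ... | no x∉L | no x∉R | inj₂ x∈R = x∉R x∈R

  -- As y does not have the colour opposite to that of x, it repeats the colour of x or has none,
  -- and then lies outside `L ∪ R`.
  clash⇒violation : ∀ {x y} → Clash (colour x) (colour y) →
    (x ∈ L × y ∈ L) ⊎ ((x ∈ R × y ∈ R) ⊎ (x ∈ L ∪ R × y ∉ L ∪ R))
  clash⇒violation {x} {y} (x≢∅ , y≢) with x ∈? L | x ∈? R | y ∈? L | y ∈? R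
  ... | yes x∈L | _       | yes y∈L | _       = inj₁ (x∈L , y∈L)
  ... | yes _   | _       | no _    | yes _   = contradiction refl y≢
  ... | yes x∈L | _       | no y∉L  | no y∉R  = inj₂ (inj₂ (p⊆p∪q R x∈L , [ y∉L , y∉R ]′ ∘ x∈p∪q⁻ L R))
  ... | no _    | yes _   | yes _   | _       = contradiction refl y≢
  ... | no _    | yes x∈R | no _    | yes y∈R = inj₂ (inj₁ (x∈R , y∈R))
  ... | no _    | yes x∈R | no y∉L  | no y∉R  = inj₂ (inj₂ (q⊆p∪q L R x∈R , [ y∉L , y∉R ]′ ∘ x∈p∪q⁻ L R))
  ... | no _    | no _    | _       | _       = contradiction refl x≢∅

  -- The numerator of `b`.
  violations : ℕ
  violations = e G L L + e G R R + length (∂ G (L ∪ R))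

  -- Clashes are ordered pairs, as are those counted by `e`; the ones leaving `L ∪ R` are cut pairs,
  -- one for each boundary edge.
  clashes≤violations : count₂ (λ x y → adj? x y ×-dec clash? (colour x) (colour y)) ℕ.≤ violations
  clashes≤violations = begin
    count₂ clash-edge?                                        ≤⟨ count₂-⊎ clash-edge? (within? L) other? (λ (adj , c) →
      [ (λ (x∈ , y∈) → inj₁ (x∈ , y∈ , adj))
      , [ (λ (x∈ , y∈) → inj₂ (inj₁ (x∈ , y∈ , adj))) , (λ c → inj₂ (inj₂ (adj , c))) ]′ ]′ (clash⇒violation c)) ⟩
    count₂ (within? L) + count₂ other?                        ≤⟨ ℕ.+-monoʳ-≤ (count₂ (within? L))
      (count₂-⊎ other? (within? R) (cut? G (L ∪ R)) id) ⟩
    count₂ (within? L) + (count₂ (within? R) + count₂ (cut? G (L ∪ R)))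
      ≤⟨ ℕ.+-monoʳ-≤ (count₂ (within? L)) (ℕ.+-monoʳ-≤ (count₂ (within? R)) (cut≤length-∂ G (L ∪ R))) ⟩
    count₂ (within? L) + (count₂ (within? R) + length (∂ G (L ∪ R)))
      ≡⟨ cong₂ (λ l r → l + (r + length (∂ G (L ∪ R)))) (within≡e L) (within≡e R) ⟩
    e G L L + (e G R R + length (∂ G (L ∪ R)))                ≡⟨ ℕ.+-assoc (e G L L) _ _ ⟨
    violations                                                ∎
    where
    open ℕ.≤-Reasoning

    clash-edge? : ∀ x y → Dec (Adj x y × Clash (colour x) (colour y))
    clash-edge? x y = adj? x y ×-dec clash? (colour x) (colour y)

    within? : (A : Subset n) → ∀ x y → Dec (x ∈ A × y ∈ A × Adj x y)
    within? A x y = (x ∈? A) ×-dec (y ∈? A) ×-dec adj? x y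

    other? : ∀ x y → Dec ((x ∈ R × y ∈ R × Adj x y) ⊎ (Adj x y × x ∈ L ∪ R × y ∉ L ∪ R))
    other? x y = within? R x y ⊎-dec cut? G (L ∪ R) x y

    within≡e : (A : Subset n) → count₂ (within? A) ≡ e G A A
    within≡e A = sym (length-filter-pairs (λ (x , y) → within? A x y))

-- The group structure carried over to `Fin n`

module Transport {c ℓ} (X : Group c ℓ) (enum : X HasOrder n) where
  open Group X using (_∙_; ε; _⁻¹)
  open Inverse enum using (to; from; to-cong; from-cong; strictlyInverseˡ; strictlyInverseʳ)

  rawGroup : RawGroup _ _
  rawGroup = record
    { Carrier = Fin n
    ; _≈_     = _≡_
    ; _∙_     = λ g h → to (from g ∙ from h)
    ; ε       = to ε
    ; _⁻¹     = λ g → to (from g ⁻¹)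
    }

  -- The group axioms pull back along the injective homomorphism `from`. The product is literally
  -- the one in the adjacency of `cayleyGraph`, so `adj⁻` can be `id`.
  isGroup : IsGroup _≡_ (RawGroup._∙_ rawGroup) (RawGroup.ε rawGroup) (RawGroup._⁻¹ rawGroup)
  isGroup = GroupMonomorphism.isGroup {G₁ = rawGroup} {G₂ = Group.rawGroup X} {⟦_⟧ = from} (record
    { isGroupHomomorphism = record
      { isMonoidHomomorphism = record
        { isMagmaHomomorphism = record
          { isRelHomomorphism = record { cong = from-cong }
          ; homo = λ g h → strictlyInverseʳ (from g ∙ from h)
          }
        ; ε-homo = strictlyInverseʳ ε
        }
      ; ⁻¹-homo = λ g → strictlyInverseʳ (from g ⁻¹)
      }
    ; injective = λ {g} {h} eq →
        trans (sym (strictlyInverseˡ g)) (trans (to-cong eq) (strictlyInverseˡ h))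
    }) (Group.isGroup X)

-- Rational comparisons

toℚᵘ-/ : ∀ i k .{{_ : NonZero k}} → ℚ.toℚᵘ (i / k) ℚᵘ.≃ i ℚᵘ./ k
toℚᵘ-/ i k@(suc _) = ℚ.toℚᵘ-fromℚᵘ (i ℚᵘ./ k)

/-mono-≤ : ∀ i j k l .{{_ : NonZero j}} .{{_ : NonZero l}} →
           i ℕ.* l ℕ.≤ k ℕ.* j → + i / j ≤ + k / l
/-mono-≤ i j@(suc _) k l@(suc _) le = ℚ.toℚᵘ-cancel-≤
  (ℚᵘ.≤-respˡ-≃ (ℚᵘ.≃-sym (toℚᵘ-/ (+ i) j)) (ℚᵘ.≤-respʳ-≃ (ℚᵘ.≃-sym (toℚᵘ-/ (+ k) l))
    (ℚᵘ.*≤* (subst₂ ℤ._≤_ (ℤ.pos-* i l) (ℤ.pos-* k j) (ℤ.+≤+ le)))))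

/-cancel-< : ∀ i j k l .{{_ : NonZero j}} .{{_ : NonZero l}} →
             + i / j < + k / l → i ℕ.* l ℕ.< k ℕ.* j
/-cancel-< i j k l lt = ℕ.≰⇒> λ le → ℚ.<-irrefl refl (ℚ.<-≤-trans lt (/-mono-≤ k l i j le))

*-/ : ∀ i j k .{{_ : NonZero k}} → (+ i / 1) * (+ j / k) ≡ + (i ℕ.* j) / k
*-/ i j k@(suc _) = ℚ.toℚᵘ-injective (begin
  ℚ.toℚᵘ ((+ i / 1) * (+ j / k))                ≈⟨ ℚ.toℚᵘ-homo-* (+ i / 1) (+ j / k) ⟩
  ℚ.toℚᵘ (+ i / 1) ℚᵘ.* ℚ.toℚᵘ (+ j / k)        ≈⟨ ℚᵘ.*-cong (toℚᵘ-/ (+ i) 1) (toℚᵘ-/ (+ j) k) ⟩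
  (+ i ℚᵘ./ 1) ℚᵘ.* (+ j ℚᵘ./ k)                ≈⟨ ℚᵘ.*≡* (cong₂ ℤ._*_ (sym (ℤ.pos-* i j)) (cong +_ (sym (ℕ.*-identityˡ k)))) ⟩
  + (i ℕ.* j) ℚᵘ./ k                            ≈⟨ toℚᵘ-/ (+ (i ℕ.* j)) k ⟨
  ℚ.toℚᵘ (+ (i ℕ.* j) / k)                      ∎)
  where open ≈-Reasoning ℚᵘ.≃-setoid

-- After multiplying by q, this is p q ≤ p.
p≤p÷q : ∀ p q .{{_ : ℚ.NonZero q}} → 0ℚ ≤ p → 0ℚ < q → q ≤ 1ℚ → p ≤ p ÷ q
p≤p÷q p q 0≤p 0<q q≤1 = ℚ.*-cancelʳ-≤-pos q (begin
  p * q          ≤⟨ ℚ.*-monoˡ-≤-nonNeg p q≤1 ⟩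
  p * 1ℚ         ≡⟨ cong (p *_) (ℚ.*-inverseˡ q) ⟨
  p * (ℚ.1/ q * q) ≡⟨ ℚ.*-assoc p (ℚ.1/ q) q ⟨
  (p ÷ q) * q    ∎)
  where
  open ℚ.≤-Reasoning
  instance
    p≥0 = ℚ.nonNegative 0≤p
    q>0 = ℚ.positive 0<q

p<1⇒0<1-p : ∀ {p} → p < 1ℚ → 0ℚ < 1ℚ - p
p<1⇒0<1-p {p} p<1 = subst (_< 1ℚ - p) (ℚ.+-inverseʳ p) (ℚ.+-monoˡ-< (ℚ.- p) p<1)

0≤p⇒1-p≤1 : ∀ {p} → 0ℚ ≤ p → 1ℚ - p ≤ 1ℚ
0≤p⇒1-p≤1 {p} 0≤p = subst (1ℚ - p ≤_) (ℚ.+-identityʳ 1ℚ) (ℚ.+-monoʳ-≤ 1ℚ (ℚ.neg-antimono-≤ 0≤p))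

module _ (k : ℕ) {β : ℚ} where

  0≤kβ : 0ℚ ≤ β → 0ℚ ≤ (+ k / 1) * β
  0≤kβ 0≤β = subst (_≤ (+ k / 1) * β) (ℚ.*-zeroʳ (+ k / 1))
    (ℚ.*-monoˡ-≤-nonNeg (+ k / 1) {{ℚ.normalize-nonNeg k 1}} 0≤β)

  β<1/k⇒kβ<1 : .{{_ : NonZero k}} → β < + 1 / k → (+ k / 1) * β < 1ℚ
  β<1/k⇒kβ<1 β<1/k = subst ((+ k / 1) * β <_) (k*1/k≡1 k)
    (ℚ.*-monoʳ-<-pos (+ k / 1) {{ℚ.normalize-pos k 1}} β<1/k)

-- The Cheeger bound for Cayley graphs

module _ {c ℓ} (X : Group c ℓ) (enum : X HasOrder n) (S : Subset n)
  (S⁻¹=S : IsInverseClosed X enum S) (d : ℕ) .{{d≢0 : NonZero d}}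
  where

  private
    G = cayleyGraph X enum S S⁻¹=S

  -- If the bound failed, every admissible A would have expansion at least h, hence above 100 b.
  -- That is `expanding`, which is contradictory; since the order on ℚ is decidable, this suffices.
  cheeger≤100b : ¬ Bipartite G → ∀ {h} → IsEdgeCheegerConstant G d h →
                 ∀ L R (L∪R≢∅ : Nonempty (L ∪ R)) .{{_ : NonZero (16 ℕ.* d)}} →
                 b G d L R L∪R≢∅ < + 1 / (16 ℕ.* d) →
                 h ≤ (+ 100 / 1) * b G d L R L∪R≢∅
  cheeger≤100b ¬bip {h} (_ , h≤) L R L∪R≢∅@(x , x∈) b< = decidable-stable (h ℚ.≤? _) λ h≰ →
    LeftInvariant.¬expanding G S (Transport.isGroup X enum) id (λ _ s∈S → _ , s∈S , refl)
      ¬bip (colour G L R) (L ∪ R) (uncoloured⇒∉ G L R) E 16E<m (ℕ.m≤n+m _ (e G L L + e G R R))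
      (clashes≤violations G L R) λ A 0<∣A∣ 2∣A∣≤n → ℕ.≰⇒> λ le →
        h≰ (ℚ.≤-trans (h≤ (A , 0<∣A∣ , 2∣A∣≤n)) (expansion≤ A 0<∣A∣ le))
    where
    E = violations G L R
    m = ∣ L ∪ R ∣

    instance
      n≢0 : NonZero n
      n≢0 = Fin.nonZeroIndex x
      m≢0 : NonZero m
      m≢0 = >-nonZero (ℕ.≤-<-trans z≤n (x∈p⇒∣p-x∣<∣p∣ x∈))
      dm≢0 : NonZero (d ℕ.* m)
      dm≢0 = m*n≢0 d m

    -- The hypothesis E / (d m) < 1 / (16 d), cross-multiplied, with d cancelled.
    16E<m : 16 ℕ.* E ℕ.< m
    16E<m = ℕ.*-cancelˡ-< d _ _ $ begin-strict
      d ℕ.* (16 ℕ.* E)    ≡⟨ shuffle d E ⟩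
      E ℕ.* (16 ℕ.* d)    <⟨ /-cancel-< E (d ℕ.* m) 1 (16 ℕ.* d) b< ⟩
      1 ℕ.* (d ℕ.* m)     ≡⟨ ℕ.*-identityˡ (d ℕ.* m) ⟩
      d ℕ.* m             ∎
      where
      open ℕ.≤-Reasoning
      shuffle : ∀ x y → x ℕ.* (16 ℕ.* y) ≡ y ℕ.* (16 ℕ.* x)
      shuffle = solve-∀

    expansion≤ : ∀ A (0<∣A∣ : 0 ℕ.< ∣ A ∣) → m ℕ.* length (∂ G A) ℕ.≤ 100 ℕ.* (E ℕ.* ∣ A ∣) →
                 expansion G d A 0<∣A∣ ≤ (+ 100 / 1) * b G d L R L∪R≢∅
    expansion≤ A 0<∣A∣ le = subst (expansion G d A 0<∣A∣ ≤_) (sym (*-/ 100 E (d ℕ.* m)))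
      (/-mono-≤ (length (∂ G A)) (d ℕ.* ∣ A ∣) (100 ℕ.* E) (d ℕ.* m) (begin
        length (∂ G A) ℕ.* (d ℕ.* m)     ≡⟨ shuffle₁ (length (∂ G A)) d m ⟩
        d ℕ.* (m ℕ.* length (∂ G A))     ≤⟨ ℕ.*-monoʳ-≤ d le ⟩
        d ℕ.* (100 ℕ.* (E ℕ.* ∣ A ∣))    ≡⟨ shuffle₂ d E ∣ A ∣ ⟩
        (100 ℕ.* E) ℕ.* (d ℕ.* ∣ A ∣)    ∎))
      where
      open ℕ.≤-Reasoning
      instance
        a≢0 : NonZero ∣ A ∣
        a≢0 = >-nonZero 0<∣A∣
        da≢0 : NonZero (d ℕ.* ∣ A ∣)
        da≢0 = m*n≢0 d ∣ A ∣
      shuffle₁ : ∀ x y z → x ℕ.* (y ℕ.* z) ≡ y ℕ.* (z ℕ.* x)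
      shuffle₁ = solve-∀
      shuffle₂ : ∀ x y z → x ℕ.* (100 ℕ.* (y ℕ.* z)) ≡ (100 ℕ.* y) ℕ.* (x ℕ.* z)
      shuffle₂ = solve-∀

  0≤b : ∀ L R (L∪R≢∅ : Nonempty (L ∪ R)) → 0ℚ ≤ b G d L R L∪R≢∅
  0≤b L R (x , x∈) = ℚ.nonNegative⁻¹ _ {{ℚ.normalize-nonNeg (violations G L R) (d ℕ.* ∣ L ∪ R ∣)}}
    where
    instance
      m≢0 : NonZero ∣ L ∪ R ∣
      m≢0 = >-nonZero (ℕ.≤-<-trans z≤n (x∈p⇒∣p-x∣<∣p∣ x∈))
      dm≢0 : NonZero (d ℕ.* ∣ L ∪ R ∣)
      dm≢0 = m*n≢0 d ∣ L ∪ R ∣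

theorem4 :
  ∀ {c ℓ} (X : Group c ℓ) (n : ℕ) (enum : X HasOrder n)
    (S : Subset n) (d : ℕ) (∣S∣≡d : ∣ S ∣ ≡ d) →
    IsGenerating X enum S →
    (S⁻¹=S : IsInverseClosed X enum S) →
    let G = cayleyGraph X enum S S⁻¹=S in
    (¬bip : ¬ Bipartite G) →
    let instance
          d≢0 : NonZero d
          d≢0 = ¬bipartite⇒∣S∣≢0 X enum S S⁻¹=S ∣S∣≡d ¬bip
          16d≢0 : NonZero (16 ℕ.* d)
          16d≢0 = m*n≢0 16 d
    in
    (h β : ℚ) →
    IsEdgeCheegerConstant G d h →
    IsBipartitenessConstant G d β →
    (β<1/16d : β < + 1 / (16 ℕ.* d)) →
    let instance
          1-16dβ≢0 = 1-kβ≢0 (16 ℕ.* d) β<1/16d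
    in
    h ≤ ((+ 100 / 1) * β) ÷ (1ℚ - (+ (16 ℕ.* d) / 1) * β)
theorem4 X n enum S d ∣S∣≡d _ S⁻¹=S ¬bip h _ isCheeger ((((L , R) , _ , L∪R≢∅) , refl) , _) β<1/16d =
  -- As 0 ≤ 16 d β < 1, the denominator 1 - 16 d β lies in (0 , 1], so dividing 100 β by it cannot
  -- decrease it.
  ℚ.≤-trans (cheeger≤100b X enum S S⁻¹=S d ¬bip isCheeger L R L∪R≢∅ β<1/16d)
    (p≤p÷q ((+ 100 / 1) * β) (1ℚ - (+ (16 ℕ.* d) / 1) * β) (0≤kβ 100 0≤β)
      (p<1⇒0<1-p (β<1/k⇒kβ<1 (16 ℕ.* d) β<1/16d)) (0≤p⇒1-p≤1 (0≤kβ (16 ℕ.* d) 0≤β)))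
  where
  instance
    d≢0 : NonZero d
    d≢0 = ¬bipartite⇒∣S∣≢0 X enum S S⁻¹=S ∣S∣≡d ¬bip
    16d≢0 : NonZero (16 ℕ.* d)
    16d≢0 = m*n≢0 16 d
    1-16dβ≢0 = 1-kβ≢0 (16 ℕ.* d) β<1/16d
  β = b (cayleyGraph X enum S S⁻¹=S) d L R L∪R≢∅
  0≤β : 0ℚ ≤ β
  0≤β = 0≤b X enum S S⁻¹=S d L R L∪R≢∅
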